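{- The Baxter equivalence relation is a lattice congruence of the permutohedron; that is, for every $n \geq 0$, the restriction of $\equiv_{\mathrm{B}}$ to $\mathfrak{S}_n$ is a lattice congruence of the lattice $(\mathfrak{S}_n, \leq_{\mathrm{P}})$.
   Context: $A = \{a_1 < a_2 < \cdots\}$ is a totally ordered infinite alphabet and $A^*$ is the free monoid of words on $A$. The Baxter congruence $\equiv_{\mathrm{B}}$ is the smallest congruence (equivalence relation compatible with concatenation) on $A^*$ such that, for all words $u, v \in A^*$ and letters $a,b,c,d \in A$: $\; c\,u\,a d\,v\,b \equiv_{\mathrm{B}} c\,u\,d a\,v\,b$ whenever $a \leq b < c \leq d$, and $\; b\,u\,d a\,v\,c \equiv_{\mathrm{B}} b\,u\,a d\,v\,c$ whenever $a < b \leq c < d$. $\mathfrak{S}_n$ is the set of permutations of size $n$, seen as words of length $n$ without repetition on the first $n$ letters of $A$ (identified with $1,\dots,n$). The permutohedron order $\leq_{\mathrm{P}}$ on $\mathfrak{S}_n$ is the partial order in which $\sigma$ is covered by $\nu$ iff $\sigma = u\,ab\,v$ and $\nu = u\,ba\,v$ for some words $u, v$ and letters $a < b$; it is a lattice. An equivalence relation $\equiv$ on a lattice $(L,\wedge,\vee)$ is a lattice congruence if for all $x,x',y,y' \in L$, $x \equiv x'$ and $y \equiv y'$ imply $x \wedge y \equiv x' \wedge y'$ and $x \vee y \equiv x' \vee y'$. -}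

module Defs where

open import Data.Empty using (⊥; ⊥-elim)
open import Data.List.Base
  using (List; []; _∷_; [_]; _++_; length; reverse; upTo)
open import Data.List.Properties
  using (length-++; length-upTo; upTo-∷ʳ; ++-identityʳ; ++-ʳ++;
         reverse-involutive; ʳ++-defn)
open import Data.List.Membership.Propositional using (_∈_; _∉_)
open import Data.List.Membership.Propositional.Properties
  using (∈-∃++; ∈-insert; ∈-++⁺ˡ; ∈-++⁺ʳ; ∈-++⁻; ∈-upTo⁺; ∈-upTo⁻)
open import Data.List.Membership.DecPropositional using (_∈?_)
open import Data.List.Relation.Binary.Lex.Core using (this; next)
import Data.List.Relation.Binary.Lex.Strict as Lex
open import Data.List.Relation.Binary.Pointwise using (Pointwise-≡⇒≡; ≡⇒Pointwise-≡)
open import Data.List.Relation.Binary.Permutation.Propositional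
  using (_↭_; ↭-refl; ↭-reflexive; ↭-sym; ↭-trans; ↭⇒↭ₛ; prep; swap)
open import Data.List.Relation.Binary.Permutation.Propositional.Properties
  using (∈-resp-↭; drop-mid; shift; ++⁺ˡ; ↭-length; ↭-reverse)
import Data.List.Relation.Binary.Permutation.Setoid.Properties as Permutationₛ
open import Data.List.Relation.Unary.All as All using (All; []; _∷_)
open import Data.List.Relation.Unary.AllPairs using ([]; _∷_)
open import Data.List.Relation.Unary.Any using (here; there)
open import Data.List.Relation.Unary.Unique.Propositional using (Unique)
open import Data.List.Relation.Unary.Unique.Propositional.Properties using (upTo⁺)
open import Data.Nat.Base using (ℕ; zero; suc; _≤_; _<_; s≤s⁻¹)
open import Data.Nat.Properties
  using (_≟_; <-cmp; <-irrefl; <-asym; <-trans; <-resp₂-≡; <⇒≢; <⇒≱; n<1+n;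
         +-cancelˡ-≡; +-identityʳ)
open import Data.Product.Base using (∃; ∃₂; _×_; _,_)
open import Data.Sum.Base using (_⊎_; inj₁; inj₂)
open import Function.Base using (_∘_; _on_)
open import Level using (Level; _⊔_; 0ℓ)
open import Relation.Binary.Core using (Rel; _⇒_)
open import Relation.Binary.Structures using (IsEquivalence)
open import Relation.Binary.Construct.Closure.ReflexiveTransitive
  using (Star; ε; _◅_; _◅◅_; gmap)
open import Relation.Binary.Lattice.Bundles using (Lattice)
open import Relation.Binary.Definitions using (tri<; tri≈; tri>)
open import Relation.Binary.PropositionalEquality
  using (_≡_; _≢_; refl; sym; trans; subst; subst₂; setoid)
  renaming (isEquivalence to ≡-isEquivalence)
open import Relation.Nullary using (yes; no)
open import Algebra.Core using (Op₂)
open import Algebra.Definitions using (Congruent₂)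

-- The alphabet is ℕ with its usual order; the letter a₍ᵢ₊₁₎ is the number i, so
-- that the first n letters are 0, …, n-1.
Word : Set
Word = List ℕ

data BaxterRule : Rel Word 0ℓ where
  rule₁ : ∀ u v {a b c d} → a ≤ b → b < c → c ≤ d →
          BaxterRule (c ∷ u ++ a ∷ d ∷ v ++ [ b ]) (c ∷ u ++ d ∷ a ∷ v ++ [ b ])
  rule₂ : ∀ u v {a b c d} → a < b → b ≤ c → c < d →
          BaxterRule (b ∷ u ++ d ∷ a ∷ v ++ [ c ]) (b ∷ u ++ a ∷ d ∷ v ++ [ c ])

infix 4 _≡B_

data _≡B_ : Rel Word 0ℓ where
  B-rule  : ∀ {x y} → BaxterRule x y → x ≡B y
  B-refl  : ∀ {x} → x ≡B x
  B-sym   : ∀ {x y} → x ≡B y → y ≡B x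
  B-trans : ∀ {x y z} → x ≡B y → y ≡B z → x ≡B z
  B-++    : ∀ {x x′ y y′} → x ≡B x′ → y ≡B y′ → x ++ y ≡B x′ ++ y′

record 𝔖 (n : ℕ) : Set where
  field
    word     : Word
    length≡n : length word ≡ n
    unique   : Unique word
    letters  : All (_< n) word

open 𝔖 public using (word)

infix 4 _⋖_ _≤P_

data _⋖_ : Rel Word 0ℓ where
  swap : ∀ u v {a b} → a < b → (u ++ a ∷ b ∷ v) ⋖ (u ++ b ∷ a ∷ v)

-- Swapping two letters of a word in 𝔖 n yields a word in 𝔖 n, so a chain of
-- covers between two permutations passes through permutations only.
_≤P_ : ∀ {n} → Rel (𝔖 n) 0ℓ
_≤P_ = Star _⋖_ on word

record IsLatticeCongruence {c ℓ₁ ℓ₂ ℓ : Level} (L : Lattice c ℓ₁ ℓ₂)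
         (_~_ : Rel (Lattice.Carrier L) ℓ) : Set (c ⊔ ℓ₁ ⊔ ℓ) where
  open Lattice L using (_≈_; _∧_; _∨_)
  field
    -- The carrier is a setoid, so _~_ must be a relation on its ≈-classes.
    ≈⇒~           : _≈_ ⇒ _~_
    isEquivalence : IsEquivalence _~_
    ∧-cong        : Congruent₂ _~_ _∧_
    ∨-cong        : Congruent₂ _~_ _∨_

-- The rest of the module shows that _≤P_ is a lattice order on 𝔖 n, by way of
-- its description as inclusion of inversion sets.

data Before (x y : ℕ) : Word → Set where
  here  : ∀ {w} → y ∈ w → Before x y (x ∷ w)
  there : ∀ {z w} → Before x y w → Before x y (z ∷ w)

infix 4 _⊑_

_⊑_ : Rel Word 0ℓ
σ ⊑ ν = ∀ {a b} → a < b → Before b a σ → Before b a ν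

private
  variable
    n x y : ℕ
    w σ ν ρ : Word

  All∉ : ∀ {z} → All (z ≢_) w → z ∉ w
  All∉ ne z∈w = All.lookup ne z∈w refl

before-∈ˡ : Before x y w → x ∈ w
before-∈ˡ (here _)  = here refl
before-∈ˡ (there p) = there (before-∈ˡ p)

before-∈ʳ : Before x y w → y ∈ w
before-∈ʳ (here p)  = there p
before-∈ʳ (there p) = there (before-∈ʳ p)

before-asym : Unique w → Before x y w → Before y x w → ⊥
before-asym (ne ∷ _)  (here p)  (here q)  = All∉ ne p
before-asym (ne ∷ _)  (here p)  (there q) = All∉ ne (before-∈ʳ q)
before-asym (ne ∷ _)  (there p) (here q)  = All∉ ne (before-∈ʳ p)
before-asym (_ ∷ uw)  (there p) (there q) = before-asym uw p q

before-total : x ∈ w → y ∈ w → x ≢ y → Before x y w ⊎ Before y x w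
before-total (here refl) (here refl) x≢y = ⊥-elim (x≢y refl)
before-total (here refl) (there q)   _   = inj₁ (here q)
before-total (there p)   (here refl) _   = inj₂ (here p)
before-total (there p)   (there q)   x≢y with before-total p q x≢y
... | inj₁ r = inj₁ (there r)
... | inj₂ r = inj₂ (there r)

∈-ins : ∀ u {w} → x ∈ u ++ w → x ∈ u ++ n ∷ w
∈-ins u p with ∈-++⁻ u p
... | inj₁ q = ∈-++⁺ˡ q
... | inj₂ q = ∈-++⁺ʳ u (there q)

∈-del : ∀ u {w} → x ≢ n → x ∈ u ++ n ∷ w → x ∈ u ++ w
∈-del u x≢n p with ∈-++⁻ u p
... | inj₁ q           = ∈-++⁺ˡ q
... | inj₂ (here refl) = ⊥-elim (x≢n refl)
... | inj₂ (there q)   = ∈-++⁺ʳ u q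

before-ins : ∀ u {w} → Before x y (u ++ w) → Before x y (u ++ n ∷ w)
before-ins []      p         = there p
before-ins (_ ∷ u) (here p)  = here (∈-ins u p)
before-ins (_ ∷ u) (there p) = there (before-ins u p)

before-del : ∀ u {w} → x ≢ n → y ≢ n → Before x y (u ++ n ∷ w) → Before x y (u ++ w)
before-del []      x≢n _   (here p)  = ⊥-elim (x≢n refl)
before-del []      _   _   (there p) = p
before-del (_ ∷ u) _   y≢n (here p)  = here (∈-del u y≢n p)
before-del (_ ∷ u) x≢n y≢n (there p) = there (before-del u x≢n y≢n p)

before-++ʳ : ∀ u {w} → Before x y w → Before x y (u ++ w)
before-++ʳ []      p = p
before-++ʳ (_ ∷ u) p = there (before-++ʳ u p)

before-suffix : ∀ u {w} → Unique (u ++ w) → x ∈ w → Before x y (u ++ w) → Before x y w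
before-suffix []      _         _ p         = p
before-suffix (_ ∷ u) (ne ∷ _)  q (here _)  = ⊥-elim (All∉ ne (∈-++⁺ʳ u q))
before-suffix (_ ∷ u) (_ ∷ uw)  q (there p) = before-suffix u uw q p

before-head : Unique (x ∷ w) → Before x y (x ∷ w) → y ∈ w
before-head _        (here p)  = p
before-head (ne ∷ _) (there p) = ⊥-elim (All∉ ne (before-∈ˡ p))

before-after : ∀ u {w} → Unique (u ++ n ∷ w) → Before n y (u ++ n ∷ w) → y ∈ w
before-after []      un       p         = before-head un p
before-after (_ ∷ u) (ne ∷ _) (here _)  = ⊥-elim (All∉ ne (∈-insert u))
before-after (_ ∷ u) (_ ∷ un) (there p) = before-after u un p

before-prefix : ∀ u {w} → x ∈ u → Before x n (u ++ n ∷ w)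
before-prefix (_ ∷ u) (here refl) = here (∈-insert u)
before-prefix (_ ∷ u) (there p)   = there (before-prefix u p)

unique-resp-↭ : σ ↭ ν → Unique σ → Unique ν
unique-resp-↭ p = Permutationₛ.Unique-resp-↭ (setoid ℕ) (↭⇒↭ₛ p)

⋖⇒↭ : σ ⋖ ν → σ ↭ ν
⋖⇒↭ (swap u v _) = ++⁺ˡ u (swap _ _ ↭-refl)

⋖⇒⊑ : σ ⋖ ν → σ ⊑ ν
⋖⇒⊑ (swap []      v a<b) c<d (here (here refl)) = ⊥-elim (<-asym a<b c<d)
⋖⇒⊑ (swap []      v a<b) c<d (here (there p))   = there (here p)
⋖⇒⊑ (swap []      v a<b) c<d (there (here p))   = here (there p)
⋖⇒⊑ (swap []      v a<b) c<d (there (there p))  = there (there p)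
⋖⇒⊑ (swap (_ ∷ u) v a<b) c<d (here p)           = here (∈-resp-↭ (⋖⇒↭ (swap u v a<b)) p)
⋖⇒⊑ (swap (_ ∷ u) v a<b) c<d (there p)          = there (⋖⇒⊑ (swap u v a<b) c<d p)

Star⇒⊑ : Star _⋖_ σ ν → σ ⊑ ν
Star⇒⊑ ε       _   p = p
Star⇒⊑ (s ◅ r) a<b p = Star⇒⊑ r a<b (⋖⇒⊑ s a<b p)

⋖-∷ : ∀ z → σ ⋖ ν → (z ∷ σ) ⋖ (z ∷ ν)
⋖-∷ z (swap u v a<b) = swap (z ∷ u) v a<b

bubble : ∀ u {t w} → (∀ {x} → x ∈ u → x < t) → Star _⋖_ (u ++ t ∷ w) (t ∷ u ++ w)
bubble []      _  = ε
bubble (z ∷ u) lt =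
  gmap (z ∷_) (⋖-∷ z) (bubble u (lt ∘ there)) ◅◅ (swap [] _ (lt (here refl)) ◅ ε)

⊑⇒Star : Unique ν → σ ↭ ν → σ ⊑ ν → Star _⋖_ σ ν
⊑⇒Star {ν = []} _ σ↭ν _ with ↭-length σ↭ν
⊑⇒Star {ν = []} {σ = []} _ σ↭ν _ | _ = ε
⊑⇒Star {ν = t ∷ ν} un@(ne ∷ unν) σ↭ν σ⊑ν with ∈-∃++ (∈-resp-↭ (↭-sym σ↭ν) (here refl))
... | u , w , refl = bubble u small ◅◅ gmap (t ∷_) (⋖-∷ t) (⊑⇒Star unν rest rest⊑)
  where
  rest : u ++ w ↭ ν
  rest = drop-mid u [] σ↭ν

  before-t : ∀ {x} → Before x t (t ∷ ν) → ⊥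
  before-t (here p)  = All∉ ne p
  before-t (there p) = All∉ ne (before-∈ʳ p)

  small : ∀ {x} → x ∈ u → x < t
  small {x} p with <-cmp x t
  ... | tri< x<t _ _    = x<t
  ... | tri≈ _ refl _   = ⊥-elim (All∉ ne (∈-resp-↭ rest (∈-++⁺ˡ p)))
  ... | tri> _ _ t<x    = ⊥-elim (before-t (σ⊑ν t<x (before-prefix u p)))

  rest⊑ : (u ++ w) ⊑ ν
  rest⊑ a<b p with σ⊑ν a<b (before-ins u p)
  ... | there q = q
  ... | here _  = ⊥-elim (All∉ ne (∈-resp-↭ rest (before-∈ˡ p)))

-- Each cover increases a word lexicographically; this gives antisymmetry.
Star⇒lex : Star _⋖_ σ ν → Lex.Lex-≤ _≡_ _<_ σ ν
Star⇒lex ε       = Lex.≤-reflexive _≡_ _<_ (≡⇒Pointwise-≡ refl)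
Star⇒lex (s ◅ r) =
  Lex.≤-transitive ≡-isEquivalence <-resp₂-≡ <-trans (step s) (Star⇒lex r)
  where
  step : ∀ {σ ν} → σ ⋖ ν → Lex.Lex-≤ _≡_ _<_ σ ν
  step (swap []      v a<b) = this a<b
  step (swap (_ ∷ u) v a<b) = next refl (step (swap u v a<b))

Star-antisym : Star _⋖_ σ ν → Star _⋖_ ν σ → σ ≡ ν
Star-antisym p q =
  Pointwise-≡⇒≡ (Lex.≤-antisymmetric sym (λ { refl → <-irrefl refl }) <-asym
                   (Star⇒lex p) (Star⇒lex q))

firstHit : (P : Word) (w : Word) →
           ∃₂ λ t₁ t₂ → w ≡ t₁ ++ t₂ × (∀ {x} → x ∈ t₁ → x ∉ P) ×
             (∀ {y} → y ∈ t₂ → ∃ λ h → h ∈ P × h ∈ t₂ × (y ≡ h ⊎ Before h y t₂))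
firstHit P []      = [] , [] , refl , (λ ()) , (λ ())
firstHit P (z ∷ w) with _∈?_ _≟_ z P
... | yes z∈P = [] , z ∷ w , refl , (λ ()) , hit
  where
  hit : ∀ {y} → y ∈ z ∷ w → ∃ λ h → h ∈ P × h ∈ z ∷ w × (y ≡ h ⊎ Before h y (z ∷ w))
  hit (here refl) = z , z∈P , here refl , inj₁ refl
  hit (there p)   = z , z∈P , here refl , inj₂ (here p)
... | no z∉P with firstHit P w
... | t₁ , t₂ , refl , miss , hit = z ∷ t₁ , t₂ , refl , miss′ , hit
  where
  miss′ : ∀ {x} → x ∈ z ∷ t₁ → x ∉ P
  miss′ (here refl) = z∉P
  miss′ (there p)   = miss p

-- The join of σ and ν is obtained from the join of the words without their largest
-- letter by inserting this letter just before the first letter that follows it in σ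
-- or in ν.
record Join (n : ℕ) (σ ν : Word) : Set where
  field
    join   : Word
    join↭  : join ↭ upTo n
    ⊑joinˡ : σ ⊑ join
    ⊑joinʳ : ν ⊑ join
    least  : ∀ {ρ} → ρ ↭ upTo n → σ ⊑ ρ → ν ⊑ ρ → join ⊑ ρ

record Split (n : ℕ) (w : Word) : Set where
  field
    pre post : Word
    w≡       : w ≡ pre ++ n ∷ post
    rest↭    : pre ++ post ↭ upTo n

split : w ↭ upTo (suc n) → Split n w
split {n = n} p with ∈-∃++ (∈-resp-↭ (↭-sym p) (∈-upTo⁺ {suc n} (n<1+n n)))
... | u , v , refl = record
  { pre = u ; post = v ; w≡ = refl
  ; rest↭ = ↭-trans (drop-mid u (upTo n) (↭-trans p (↭-reflexive (sym (upTo-∷ʳ n)))))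
                    (↭-reflexive (++-identityʳ _)) }

unsplit : ∀ u {v} → u ++ v ↭ upTo n → u ++ n ∷ v ↭ upTo (suc n)
unsplit {n} u {v} p =
  ↭-trans (shift n u v)
    (↭-trans (prep n p)
      (↭-trans (↭-sym (↭-trans (shift n (upTo n) []) (prep n (↭-reflexive (++-identityʳ _)))))
        (↭-reflexive (upTo-∷ʳ n))))

↭upTo⇒Unique : w ↭ upTo n → Unique w
↭upTo⇒Unique p = unique-resp-↭ (↭-sym p) (upTo⁺ _)

↭upTo⇒< : w ↭ upTo n → x ∈ w → x < n
↭upTo⇒< p x∈w = ∈-upTo⁻ (∈-resp-↭ p x∈w)

insert⊑ : ∀ p s q r → (p ++ n ∷ s) ↭ upTo (suc n) → (p ++ s) ↭ upTo n →
          (p ++ s) ⊑ (q ++ r) → (∀ {y} → y ∈ s → y ∈ r) → (p ++ n ∷ s) ⊑ (q ++ n ∷ r)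
insert⊑ {n} p s q r full rest le s⊆r {a} {b} a<b bef with b ≟ n
... | yes refl = before-++ʳ q (here (s⊆r (before-after p (↭upTo⇒Unique full) bef)))
... | no b≢n = before-ins q (le a<b (before-del p b≢n a≢n bef))
  where
  a≢n : a ≢ n
  a≢n refl = <⇒≱ a<b (s≤s⁻¹ (↭upTo⇒< full (before-∈ˡ bef)))

delete⊑ : ∀ p s q r → (p ++ s) ↭ upTo n →
          (p ++ n ∷ s) ⊑ (q ++ n ∷ r) → (p ++ s) ⊑ (q ++ r)
delete⊑ p s q r rest le a<b bef =
  before-del q (<⇒≢ (↭upTo⇒< rest (before-∈ˡ bef))) (<⇒≢ (↭upTo⇒< rest (before-∈ʳ bef)))
    (le a<b (before-ins p bef))

-- Letters after n in σ remain after n in any ρ above σ.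
after⊆ : ∀ p s q r → (p ++ s) ↭ upTo n → (q ++ n ∷ r) ↭ upTo (suc n) →
         (p ++ n ∷ s) ⊑ (q ++ n ∷ r) → ∀ {y} → y ∈ s → y ∈ r
after⊆ p s q r rest full le y∈s =
  before-after q (↭upTo⇒Unique full)
    (le (↭upTo⇒< rest (∈-++⁺ʳ p y∈s)) (before-++ʳ p (here y∈s)))

module _ {n} (p s t q r : Word)
         (σ′↭ : p ++ s ↭ upTo n) (τ′↭ : t ↭ upTo n) (ρ′↭ : q ++ r ↭ upTo n)
         (σ′⊑τ′ : (p ++ s) ⊑ t) (τ′⊑ρ′ : t ⊑ (q ++ r))
         (s⊆r : ∀ {y} → y ∈ s → y ∈ r) where

  follows : ∀ {h y} → h ∈ s → Before h y t → y ∈ r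
  follows {h} {y} h∈s bef with <-cmp y h
  ... | tri< y<h _ _ =
    before-∈ʳ (before-suffix q (↭upTo⇒Unique ρ′↭) (s⊆r h∈s) (τ′⊑ρ′ y<h bef))
  ... | tri≈ _ refl _ = s⊆r h∈s
  ... | tri> _ y≢h h<y with before-total (∈-++⁺ʳ p h∈s)
                              (∈-resp-↭ (↭-trans τ′↭ (↭-sym σ′↭)) (before-∈ʳ bef)) (y≢h ∘ sym)
  ...   | inj₁ h-y = s⊆r (before-∈ʳ (before-suffix p (↭upTo⇒Unique σ′↭) h∈s h-y))
  ...   | inj₂ y-h = ⊥-elim (before-asym (↭upTo⇒Unique τ′↭) (σ′⊑τ′ h<y y-h) bef)

joins : ∀ n {σ ν} → σ ↭ upTo n → ν ↭ upTo n → Join n σ ν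
joins zero {σ} {ν} σ↭ ν↭ = record
  { join = σ ; join↭ = σ↭ ; ⊑joinˡ = λ _ p → p
  ; ⊑joinʳ = λ _ p → ⊥-elim (none ν↭ p) ; least = λ _ σ⊑ρ _ → σ⊑ρ }
  where
  none : ∀ {w x y} → w ↭ upTo 0 → Before x y w → ⊥
  none w↭ p with ∈-resp-↭ w↭ (before-∈ˡ p)
  ... | ()
joins (suc n) σ↭ ν↭ with split σ↭ | split ν↭
... | record { pre = p ; post = s ; w≡ = refl ; rest↭ = σ′↭ }
    | record { pre = p₂ ; post = s₂ ; w≡ = refl ; rest↭ = ν′↭ }
  with joins n σ′↭ ν′↭
... | J with firstHit (s ++ s₂) (Join.join J)
... | t₁ , t₂ , eq , miss , hit = record
  { join   = t₁ ++ n ∷ t₂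
  ; join↭  = unsplit t₁ τ′↭
  ; ⊑joinˡ = insert⊑ p s t₁ t₂ σ↭ σ′↭ σ′⊑ (λ y∈s → kept (∈-++⁺ˡ y∈s)
               (∈-resp-↭ (↭-trans σ′↭ (↭-sym τ′↭)) (∈-++⁺ʳ p y∈s)))
  ; ⊑joinʳ = insert⊑ p₂ s₂ t₁ t₂ ν↭ ν′↭ ν′⊑ (λ y∈s → kept (∈-++⁺ʳ s y∈s)
               (∈-resp-↭ (↭-trans ν′↭ (↭-sym τ′↭)) (∈-++⁺ʳ p₂ y∈s)))
  ; least  = least′ }
  where
  open Join J
  τ′↭ : t₁ ++ t₂ ↭ upTo n
  τ′↭ = subst (_↭ upTo n) eq join↭
  σ′⊑ : (p ++ s) ⊑ (t₁ ++ t₂)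
  σ′⊑ = subst ((p ++ s) ⊑_) eq ⊑joinˡ
  ν′⊑ : (p₂ ++ s₂) ⊑ (t₁ ++ t₂)
  ν′⊑ = subst ((p₂ ++ s₂) ⊑_) eq ⊑joinʳ

  kept : ∀ {y} → y ∈ s ++ s₂ → y ∈ t₁ ++ t₂ → y ∈ t₂
  kept y∈P y∈t with ∈-++⁻ t₁ y∈t
  ... | inj₁ y∈t₁ = ⊥-elim (miss y∈t₁ y∈P)
  ... | inj₂ y∈t₂ = y∈t₂

  least′ : ∀ {ρ} → ρ ↭ upTo (suc n) → (p ++ n ∷ s) ⊑ ρ → (p₂ ++ n ∷ s₂) ⊑ ρ →
           (t₁ ++ n ∷ t₂) ⊑ ρ
  least′ ρ↭ σ⊑ρ ν⊑ρ with split ρ↭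
  ... | record { pre = q ; post = r ; w≡ = refl ; rest↭ = ρ′↭ } =
    insert⊑ t₁ t₂ q r (unsplit t₁ τ′↭) τ′↭ τ′⊑ρ′ t₂⊆r
    where
    τ′⊑ρ′ : (t₁ ++ t₂) ⊑ (q ++ r)
    τ′⊑ρ′ = subst (_⊑ (q ++ r)) eq
      (least ρ′↭ (delete⊑ p s q r σ′↭ σ⊑ρ) (delete⊑ p₂ s₂ q r ν′↭ ν⊑ρ))
    s⊆r : ∀ {y} → y ∈ s → y ∈ r
    s⊆r = after⊆ p s q r σ′↭ ρ↭ σ⊑ρ
    s₂⊆r : ∀ {y} → y ∈ s₂ → y ∈ r
    s₂⊆r = after⊆ p₂ s₂ q r ν′↭ ρ↭ ν⊑ρ

    t₂⊆r : ∀ {y} → y ∈ t₂ → y ∈ r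
    t₂⊆r y∈t₂ with hit y∈t₂
    ... | h , h∈P , h∈t₂ , y≡h⊎h-y with ∈-++⁻ s h∈P | y≡h⊎h-y
    ... | inj₁ h∈s | inj₁ refl = s⊆r h∈s
    ... | inj₂ h∈s | inj₁ refl = s₂⊆r h∈s
    ... | inj₁ h∈s | inj₂ h-y  =
      follows p s (t₁ ++ t₂) q r σ′↭ τ′↭ ρ′↭ σ′⊑ τ′⊑ρ′ s⊆r h∈s (before-++ʳ t₁ h-y)
    ... | inj₂ h∈s | inj₂ h-y  =
      follows p₂ s₂ (t₁ ++ t₂) q r ν′↭ τ′↭ ρ′↭ ν′⊑ τ′⊑ρ′ s₂⊆r h∈s (before-++ʳ t₁ h-y)

complete : ∀ xs ys → Unique xs → (∀ {x} → x ∈ xs → x ∈ ys) → ∃ λ zs → ys ↭ xs ++ zs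
complete []       ys _         _   = ys , ↭-refl
complete (x ∷ xs) ys (ne ∷ un) sub with ∈-∃++ (sub (here refl))
... | u , v , refl with complete xs (u ++ v) un
                          (λ {y} p → ∈-del u (λ { refl → All∉ ne p }) (sub (there p)))
... | zs , q = zs , ↭-trans (shift x u v) (prep x q)

word↭ : (σ : 𝔖 n) → word σ ↭ upTo n
word↭ {n} σ with complete (word σ) (upTo n) (𝔖.unique σ) (∈-upTo⁺ ∘ All.lookup (𝔖.letters σ))
... | []     , p = ↭-sym (↭-trans p (↭-reflexive (++-identityʳ _)))
... | z ∷ zs , p with +-cancelˡ-≡ (length (word σ)) (suc (length zs)) 0
                       (trans (sym (length-++ (word σ))) (trans (sym (↭-length p))
                         (trans (length-upTo n) (trans (sym (𝔖.length≡n σ)) (sym (+-identityʳ _))))))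
... | ()

from↭ : (w : Word) → w ↭ upTo n → 𝔖 n
from↭ {n} w p = record
  { word = w ; length≡n = trans (↭-length p) (length-upTo n)
  ; unique = ↭upTo⇒Unique p ; letters = All.tabulate (↭upTo⇒< p) }

⊑⇒≤P : (σ ν : 𝔖 n) → word σ ⊑ word ν → σ ≤P ν
⊑⇒≤P σ ν = ⊑⇒Star (𝔖.unique ν) (↭-trans (word↭ σ) (↭-sym (word↭ ν)))

infixr 6 _∨P_
infixr 7 _∧P_

_∨P_ : Op₂ (𝔖 n)
_∨P_ {n} σ ν = from↭ (Join.join J) (Join.join↭ J)
  where J = joins n (word↭ σ) (word↭ ν)

-- Reading words from right to left reverses the order.
rev : 𝔖 n → 𝔖 n
rev σ = from↭ (reverse (word σ)) (↭-trans (↭-reverse _) (word↭ σ))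

_∧P_ : Op₂ (𝔖 n)
σ ∧P ν = rev (rev σ ∨P rev ν)

x≤x∨y : (σ ν : 𝔖 n) → σ ≤P σ ∨P ν
x≤x∨y {n} σ ν = ⊑⇒≤P σ (σ ∨P ν) (Join.⊑joinˡ (joins n (word↭ σ) (word↭ ν)))

y≤x∨y : (σ ν : 𝔖 n) → ν ≤P σ ∨P ν
y≤x∨y {n} σ ν = ⊑⇒≤P ν (σ ∨P ν) (Join.⊑joinʳ (joins n (word↭ σ) (word↭ ν)))

∨-least : (σ ν ρ : 𝔖 n) → σ ≤P ρ → ν ≤P ρ → σ ∨P ν ≤P ρ
∨-least {n} σ ν ρ p q = ⊑⇒≤P (σ ∨P ν) ρ
  (Join.least (joins n (word↭ σ) (word↭ ν)) (word↭ ρ) (Star⇒⊑ p) (Star⇒⊑ q))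

⋖-reverse : σ ⋖ ν → reverse ν ⋖ reverse σ
⋖-reverse (swap u v {a} {b} a<b) =
  subst₂ _⋖_ (sym (eq b a)) (sym (eq a b)) (swap (reverse v) (reverse u) a<b)
  where
  eq : ∀ c d → reverse (u ++ c ∷ d ∷ v) ≡ reverse v ++ d ∷ c ∷ reverse u
  eq c d = trans (++-ʳ++ u) (ʳ++-defn v)

Star-reverse : Star _⋖_ σ ν → Star _⋖_ (reverse ν) (reverse σ)
Star-reverse ε       = ε
Star-reverse (s ◅ r) = Star-reverse r ◅◅ (⋖-reverse s ◅ ε)

x∧y≤x : (σ ν : 𝔖 n) → σ ∧P ν ≤P σ
x∧y≤x σ ν = subst (Star _⋖_ _) (reverse-involutive (word σ))
  (Star-reverse (x≤x∨y (rev σ) (rev ν)))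

x∧y≤y : (σ ν : 𝔖 n) → σ ∧P ν ≤P ν
x∧y≤y σ ν = subst (Star _⋖_ _) (reverse-involutive (word ν))
  (Star-reverse (y≤x∨y (rev σ) (rev ν)))

∧-greatest : (σ ν ρ : 𝔖 n) → ρ ≤P σ → ρ ≤P ν → ρ ≤P σ ∧P ν
∧-greatest σ ν ρ p q = subst (λ w → Star _⋖_ w _) (reverse-involutive (word ρ))
  (Star-reverse (∨-least (rev σ) (rev ν) (rev ρ) (Star-reverse p) (Star-reverse q)))

permutohedron : ℕ → Lattice 0ℓ 0ℓ 0ℓ
permutohedron n = record
  { Carrier = 𝔖 n
  ; _≈_     = _≡_ on word
  ; _≤_     = _≤P_
  ; _∨_     = _∨P_
  ; _∧_     = _∧P_
  ; isLattice = record
    { isPartialOrder = record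
      { isPreorder = record
        { isEquivalence = record { refl = refl ; sym = sym ; trans = trans }
        ; reflexive     = λ { refl → ε }
        ; trans         = _◅◅_
        }
      ; antisym = Star-antisym
      }
    ; supremum = λ σ ν → x≤x∨y σ ν , y≤x∨y σ ν , ∨-least σ ν
    ; infimum  = λ σ ν → x∧y≤x σ ν , x∧y≤y σ ν , ∧-greatest σ ν
    }
  }

{-# OPTIONS --safe #-}

-- On permutations the Baxter relation is generated by the covers σ = u ad v ⋖ u da v = ν
-- for which both u and v contain a letter strictly between a and d.  Reversing words
-- preserves these covers, so it suffices to show that σ ∨ ρ ≡B ν ∨ ρ for such a cover.
-- Let τ = σ ∨ ρ.  If d precedes a in τ, then τ = ν ∨ ρ.  Otherwise τ = p a m d s, where p and
-- s still contain letters between a and d, while m does not: such a letter precedes a or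
-- follows d in σ, hence in τ.  Moving the letters ≥ d of a m d in front of its letters ≤ a
-- gives ν ∨ ρ, and each transposition involved is a Baxter cover.
module Submission where

open import Defs
open import Data.Empty using (⊥; ⊥-elim)
open import Data.List.Base using ([]; _∷_; [_]; _++_; reverse; upTo)
open import Data.List.Properties using (++-assoc; ++-ʳ++; ʳ++-defn)
open import Data.List.Membership.Propositional using (_∈_)
open import Data.List.Membership.Propositional.Properties
  using (∈-∃++; ∈-insert; ∈-++⁺ˡ; ∈-++⁺ʳ; ∈-++⁻)
open import Data.List.Relation.Binary.Permutation.Propositional
  using (_↭_; ↭-refl; ↭-sym; ↭-trans)
  renaming (swap to ↭-swap)
open import Data.List.Relation.Binary.Permutation.Propositional.Properties
  using (∈-resp-↭; ++⁺; ++⁺ˡ)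
import Data.List.Relation.Unary.Any.Properties as Any
open import Data.List.Relation.Unary.All as All using (All; []; _∷_)
open import Data.List.Relation.Unary.AllPairs using ([]; _∷_)
open import Data.List.Relation.Unary.Any using (here; there)
open import Data.List.Relation.Unary.Unique.Propositional using (Unique)
open import Data.Nat.Base using (ℕ; _≤_; _<_)
open import Data.Nat.Properties
  using (_≤?_; ≤-<-trans; <-≤-trans; <-trans; <⇒≤; <⇒≢; <⇒≱; ≰⇒>; ≤∧≢⇒<; m≤n⇒m<n∨m≡n)
open import Data.Product.Base using (∃; ∃₂; _×_; _,_)
open import Data.Sum.Base using (_⊎_; inj₁; inj₂)
open import Function.Base using (_∘_; _on_)
open import Level using (0ℓ)
open import Relation.Binary.Core using (Rel)
open import Relation.Binary.Construct.Closure.Equivalence as Eq using (EqClosure)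
open import Relation.Binary.Construct.Closure.ReflexiveTransitive as Star
  using (Star; ε; _◅_; _◅◅_)
open import Relation.Binary.Construct.Closure.Symmetric using (fwd; bwd)
open import Relation.Binary.PropositionalEquality
  using (_≡_; refl; sym; cong; subst; subst₂)
open import Relation.Nullary using (¬_; yes; no)

private
  variable
    n a b d x y z : ℕ
    w σ ν ρ : Word

-- Precedence of letters in words and the order `⊑`

before-irrefl : Unique w → ¬ Before x x w
before-irrefl un p = before-asym un p p

before-trans : Unique w → Before x y w → Before y z w → Before x z w
before-trans _         (here _)  (here q)  = here q
before-trans _         (here _)  (there q) = here (before-∈ʳ q)
before-trans un        (there p) (here q)  = ⊥-elim (before-irrefl un (here (before-∈ʳ p)))
before-trans (_ ∷ un)  (there p) (there q) = there (before-trans un p q)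

before-++ : ∀ {u v} → x ∈ u → y ∈ v → Before x y (u ++ v)
before-++ {u = _ ∷ u} (here refl) q = here (∈-++⁺ʳ u q)
before-++ {u = _ ∷ u} (there p)   q = there (before-++ p q)

before-++ˡ : ∀ {u} v → Before x y u → Before x y (u ++ v)
before-++ˡ v (here p)  = here (∈-++⁺ˡ p)
before-++ˡ v (there p) = there (before-++ˡ v p)

-- The bracketing keeps the factor from `x` to `y` in one piece; it is the factor that gets sorted
-- later.
before-∃++ : Before x y w → ∃₂ λ p m → ∃ λ s → w ≡ p ++ (x ∷ m ++ [ y ]) ++ s
before-∃++ (here {w} q) with ∈-∃++ q
... | m , s , refl = [] , m , s , cong (_ ∷_) (sym (++-assoc m [ _ ] s))
before-∃++ (there {z} q) with before-∃++ q
... | p , m , s , refl = z ∷ p , m , s , refl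

before-swap : ∀ u {v} → Before x y (u ++ b ∷ a ∷ v) →
              (x ≡ b × y ≡ a) ⊎ Before x y (u ++ a ∷ b ∷ v)
before-swap []      (here (here refl)) = inj₁ (refl , refl)
before-swap []      (here (there q))   = inj₂ (there (here q))
before-swap []      (there (here q))   = inj₂ (here (there q))
before-swap []      (there (there q))  = inj₂ (there (there q))
before-swap (z ∷ u) (here q)           = inj₂ (here (∈-resp-↭ (++⁺ˡ u (↭-swap _ _ ↭-refl)) q))
before-swap (z ∷ u) (there q) with before-swap u q
... | inj₁ eq = inj₁ eq
... | inj₂ r  = inj₂ (there r)

-- The transposition changes the relative order of `a` and `b` only, so `ρ` has just one new
-- inversion to supply.
swap-⊑ : ∀ u {v} → (u ++ a ∷ b ∷ v) ⊑ ρ → Before b a ρ → (u ++ b ∷ a ∷ v) ⊑ ρ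
swap-⊑ u le b-a x<y p with before-swap u p
... | inj₁ (refl , refl) = b-a
... | inj₂ q             = le x<y q

⊑-trans : σ ⊑ ν → ν ⊑ ρ → σ ⊑ ρ
⊑-trans p q a<b = q a<b ∘ p a<b

⊑-antisym : σ ↭ upTo n → ν ↭ upTo n → σ ⊑ ν → ν ⊑ σ → σ ≡ ν
⊑-antisym σ↭ ν↭ p q = Star-antisym
  (⊑⇒Star (↭upTo⇒Unique ν↭) (↭-trans σ↭ (↭-sym ν↭)) p)
  (⊑⇒Star (↭upTo⇒Unique σ↭) (↭-trans ν↭ (↭-sym σ↭)) q)

-- Baxter covers and the Baxter congruence on words without repetition

infix 4 _⋖B_

-- One constructor serves both rules, since comparing `x` with `y` decides which rule applies. The
-- witnesses may lie anywhere in `u` and `v`, which builds in closure under contexts, and they play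
-- symmetric roles, as reversal requires.
data _⋖B_ : Rel Word 0ℓ where
  swap : ∀ u v {a b x y} → x ∈ u → a < x → x < b → y ∈ v → a < y → y < b →
         (u ++ a ∷ b ∷ v) ⋖B (u ++ b ∷ a ∷ v)

⋖B⇒⋖ : σ ⋖B ν → σ ⋖ ν
⋖B⇒⋖ (swap u v _ a<x x<b _ _ _) = swap u v (<-trans a<x x<b)

⋖B⇒≡B : σ ⋖B ν → σ ≡B ν
⋖B⇒≡B (swap u v {a} {b} {x} {y} x∈u a<x x<b y∈v a<y y<b) with ∈-∃++ x∈u | ∈-∃++ y∈v
... | u₁ , u₂ , refl | v₁ , v₂ , refl =
  subst₂ _≡B_ (sym (assoc a b)) (sym (assoc b a)) (B-++ (B-refl {u₁}) (B-++ core (B-refl {v₂})))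
  where
  assoc : ∀ c d → (u₁ ++ x ∷ u₂) ++ c ∷ d ∷ v₁ ++ y ∷ v₂ ≡
                  u₁ ++ (x ∷ u₂ ++ c ∷ d ∷ v₁ ++ [ y ]) ++ v₂
  assoc c d rewrite ++-assoc u₁ (x ∷ u₂) (c ∷ d ∷ v₁ ++ y ∷ v₂)
                  | ++-assoc u₂ (c ∷ d ∷ v₁ ++ [ y ]) v₂
                  | ++-assoc v₁ [ y ] v₂ = refl

  core : (x ∷ u₂ ++ a ∷ b ∷ v₁ ++ [ y ]) ≡B (x ∷ u₂ ++ b ∷ a ∷ v₁ ++ [ y ])
  core with x ≤? y
  ... | yes x≤y = B-sym (B-rule (rule₂ u₂ v₁ a<x x≤y y<b))
  ... | no  x≰y = B-rule (rule₁ u₂ v₁ (<⇒≤ a<y) (≰⇒> x≰y) (<⇒≤ x<b))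

⋖B-++ˡ : ∀ w → σ ⋖B ν → (w ++ σ) ⋖B (w ++ ν)
⋖B-++ˡ w (swap u v {a} {b} x∈u a<x x<b y∈v a<y y<b) =
  subst₂ _⋖B_ (++-assoc w u _) (++-assoc w u _)
    (swap (w ++ u) v (∈-++⁺ʳ w x∈u) a<x x<b y∈v a<y y<b)

⋖B-++ʳ : ∀ w → σ ⋖B ν → (σ ++ w) ⋖B (ν ++ w)
⋖B-++ʳ w (swap u v x∈u a<x x<b y∈v a<y y<b) =
  subst₂ _⋖B_ (sym (++-assoc u _ w)) (sym (++-assoc u _ w))
    (swap u (v ++ w) x∈u a<x x<b (∈-++⁺ˡ y∈v) a<y y<b)

⋖B-reverse : σ ⋖B ν → reverse ν ⋖B reverse σ
⋖B-reverse (swap u v {a} {b} x∈u a<x x<b y∈v a<y y<b) =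
  subst₂ _⋖B_ (sym (eq b a)) (sym (eq a b))
    (swap (reverse v) (reverse u) (Any.reverse⁺ y∈v) a<y y<b (Any.reverse⁺ x∈u) a<x x<b)
  where
  eq : ∀ c d → reverse (u ++ c ∷ d ∷ v) ≡ reverse v ++ d ∷ c ∷ reverse u
  eq c d rewrite ++-ʳ++ u {c ∷ d ∷ v} {[]} = ʳ++-defn v

-- Carries uniqueness from one end of an equivalence to the other, as an induction through `B-sym`
-- and `B-trans` requires.
≡B⇒↭ : σ ≡B ν → σ ↭ ν
≡B⇒↭ (B-rule (rule₁ u v {c = c} _ _ _)) = ++⁺ˡ (c ∷ u) (↭-swap _ _ ↭-refl)
≡B⇒↭ (B-rule (rule₂ u v {b = b} _ _ _)) = ++⁺ˡ (b ∷ u) (↭-swap _ _ ↭-refl)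
≡B⇒↭ B-refl        = ↭-refl
≡B⇒↭ (B-sym p)     = ↭-sym (≡B⇒↭ p)
≡B⇒↭ (B-trans p q) = ↭-trans (≡B⇒↭ p) (≡B⇒↭ q)
≡B⇒↭ (B-++ p q)    = ++⁺ (≡B⇒↭ p) (≡B⇒↭ q)

unique-++⁻ˡ : ∀ u {v : Word} → Unique (u ++ v) → Unique u
unique-++⁻ˡ []      _         = []
unique-++⁻ˡ (_ ∷ u) (ne ∷ un) = All.tabulate (All.lookup ne ∘ ∈-++⁺ˡ) ∷ unique-++⁻ˡ u un

unique-++⁻ʳ : ∀ u {v : Word} → Unique (u ++ v) → Unique v
unique-++⁻ʳ []      un       = un
unique-++⁻ʳ (_ ∷ u) (_ ∷ un) = unique-++⁻ʳ u un

-- Uniqueness makes the weak inequalities in the rules strict.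
≡B⇒EqClosure : Unique σ → σ ≡B ν → EqClosure _⋖B_ σ ν
≡B⇒EqClosure un (B-rule (rule₁ u v {a} {b} {c} {d} a≤b b<c c≤d)) =
  Eq.return (swap (c ∷ u) (v ++ [ b ]) (here refl) (≤-<-trans a≤b b<c) c<d
                  (∈-insert v) a<b (<-≤-trans b<c c≤d))
  where
  a<b : a < b
  a<b = ≤∧≢⇒< a≤b λ { refl →
    before-irrefl un (before-++ʳ (c ∷ u) (here (there (∈-insert v)))) }
  c<d : c < d
  c<d = ≤∧≢⇒< c≤d λ { refl → before-irrefl un (here (∈-++⁺ʳ u (there (here refl)))) }
≡B⇒EqClosure un (B-rule (rule₂ u v {a} {b} {c} {d} a<b b≤c c<d)) =
  Eq.symmetric _⋖B_
    (Eq.return (swap (b ∷ u) (v ++ [ c ]) (here refl) a<b (≤-<-trans b≤c c<d)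
                     (∈-insert v) (<-≤-trans a<b b≤c) c<d))
≡B⇒EqClosure un B-refl        = ε
≡B⇒EqClosure un (B-sym p)     =
  Eq.symmetric _⋖B_ (≡B⇒EqClosure (unique-resp-↭ (↭-sym (≡B⇒↭ p)) un) p)
≡B⇒EqClosure un (B-trans p q) =
  ≡B⇒EqClosure un p ◅◅ ≡B⇒EqClosure (unique-resp-↭ (≡B⇒↭ p) un) q
≡B⇒EqClosure un (B-++ {x} {x′} {y} p q) =
  Eq.gmap (_++ y) (⋖B-++ʳ y) (≡B⇒EqClosure (unique-++⁻ˡ x un) p) ◅◅
  Eq.gmap (x′ ++_) (⋖B-++ˡ x′) (≡B⇒EqClosure (unique-++⁻ʳ x un) q)

EqClosure⇒≡B : EqClosure _⋖B_ σ ν → σ ≡B ν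
EqClosure⇒≡B ε           = B-refl
EqClosure⇒≡B (fwd s ◅ r) = B-trans (⋖B⇒≡B s) (EqClosure⇒≡B r)
EqClosure⇒≡B (bwd s ◅ r) = B-trans (B-sym (⋖B⇒≡B s)) (EqClosure⇒≡B r)

Star⋖B⇒≡B : Star _⋖B_ σ ν → σ ≡B ν
Star⋖B⇒≡B = EqClosure⇒≡B ∘ Star.map fwd

EqClosure-reverse : EqClosure _⋖B_ σ ν → EqClosure _⋖B_ (reverse σ) (reverse ν)
EqClosure-reverse ε           = ε
EqClosure-reverse (fwd s ◅ r) = bwd (⋖B-reverse s) ◅ EqClosure-reverse r
EqClosure-reverse (bwd s ◅ r) = fwd (⋖B-reverse s) ◅ EqClosure-reverse r

-- Reversal does not exchange the two rules, because their weak inequalities sit in different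
-- places. The detour through `_⋖B_`, where all inequalities are strict, avoids this.
≡B-reverse : Unique σ → σ ≡B ν → reverse σ ≡B reverse ν
≡B-reverse un = EqClosure⇒≡B ∘ EqClosure-reverse ∘ ≡B⇒EqClosure un

-- Sorting a factor into large and small letters

module _ (a d : ℕ) where

  -- With fixed thresholds, a letter strictly between `a` and `d` is strictly between any two
  -- letters swapped. One pair of witnesses outside the factor thus serves every step of the sort.
  data Crossing : Rel Word 0ℓ where
    swap : ∀ u v {s b} → s ≤ a → d ≤ b → Crossing (u ++ s ∷ b ∷ v) (u ++ b ∷ s ∷ v)

  Crossing-∷ : ∀ z → Crossing σ ν → Crossing (z ∷ σ) (z ∷ ν)
  Crossing-∷ z (swap u v s≤a d≤b) = swap (z ∷ u) v s≤a d≤b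

  Crossing⇒↭ : Crossing σ ν → σ ↭ ν
  Crossing⇒↭ (swap u v _ _) = ++⁺ˡ u (↭-swap _ _ ↭-refl)

  Crossing⇒⋖B : ∀ p s → x ∈ p → a < x → x < d → y ∈ s → a < y → y < d →
                Crossing σ ν → (p ++ σ ++ s) ⋖B (p ++ ν ++ s)
  Crossing⇒⋖B p s x∈p a<x x<d y∈s a<y y<d (swap u v s≤a d≤b) =
    subst₂ _⋖B_ (assoc _ _) (assoc _ _)
      (swap (p ++ u) (v ++ s)
        (∈-++⁺ˡ x∈p) (≤-<-trans s≤a a<x) (<-≤-trans x<d d≤b)
        (∈-++⁺ʳ v y∈s) (≤-<-trans s≤a a<y) (<-≤-trans y<d d≤b))
    where
    assoc : ∀ c e → (p ++ u) ++ c ∷ e ∷ v ++ s ≡ p ++ (u ++ c ∷ e ∷ v) ++ s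
    assoc c e rewrite ++-assoc p u (c ∷ e ∷ v ++ s) | ++-assoc u (c ∷ e ∷ v) s = refl

  Crossing-⊑ : ∀ p s → Crossing σ ν →
               (∀ {x y} → x ∈ σ → x ≤ a → y ∈ σ → d ≤ y → Before y x ρ) →
               (p ++ σ ++ s) ⊑ ρ → (p ++ ν ++ s) ⊑ ρ
  Crossing-⊑ {ρ = ρ} p s (swap u v {c} {b} c≤a d≤b) crossed le =
    subst (_⊑ ρ) (assoc b c)
      (swap-⊑ (p ++ u) (subst (_⊑ ρ) (sym (assoc c b)) le)
        (crossed (∈-insert u) c≤a (∈-++⁺ʳ u (there (here refl))) d≤b))
    where
    assoc : ∀ c e → (p ++ u) ++ c ∷ e ∷ v ++ s ≡ p ++ (u ++ c ∷ e ∷ v) ++ s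
    assoc c e rewrite ++-assoc p u (c ∷ e ∷ v ++ s) | ++-assoc u (c ∷ e ∷ v) s = refl

  -- The condition on `ρ` depends only on which letters occur in `σ`, so it survives each crossing.
  StarCrossing-⊑ : ∀ p s → Star Crossing σ ν →
                   (∀ {x y} → x ∈ σ → x ≤ a → y ∈ σ → d ≤ y → Before y x ρ) →
                   (p ++ σ ++ s) ⊑ ρ → (p ++ ν ++ s) ⊑ ρ
  StarCrossing-⊑ p s ε       crossed le = le
  StarCrossing-⊑ p s (c ◅ r) crossed le =
    StarCrossing-⊑ p s r (λ x∈ x≤a y∈ → crossed (back x∈) x≤a (back y∈))
      (Crossing-⊑ p s c crossed le)
    where
    back : ∀ {x} → x ∈ _ → x ∈ _
    back = ∈-resp-↭ (↭-sym (Crossing⇒↭ c))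

  StarCrossing⇒↭ : Star Crossing σ ν → σ ↭ ν
  StarCrossing⇒↭ = Star.fold _↭_ (↭-trans ∘ Crossing⇒↭) ↭-refl

  crossAll : ∀ bs {ss} → All (d ≤_) bs → x ≤ a → Star Crossing (x ∷ bs ++ ss) (bs ++ x ∷ ss)
  crossAll []       _          _   = ε
  crossAll (b ∷ bs) (d≤b ∷ ps) x≤a =
    swap [] _ x≤a d≤b ◅ Star.gmap (b ∷_) (Crossing-∷ b) (crossAll bs ps x≤a)

  -- Insertion from the right: a large letter stays in front of the sorted tail, and a small one is
  -- carried past the large letters of that tail.
  sort : All (λ z → z ≤ a ⊎ d ≤ z) w →
         ∃₂ λ bs ss → All (d ≤_) bs × All (_≤ a) ss × Star Crossing w (bs ++ ss)
  sort []                  = [] , [] , [] , [] , ε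
  sort {z ∷ _} (p ∷ ps) with sort ps
  ... | bs , ss , big , small , r with p
  ...   | inj₂ d≤z = z ∷ bs , ss , d≤z ∷ big , small , Star.gmap (z ∷_) (Crossing-∷ z) r
  ...   | inj₁ z≤a = bs , z ∷ ss , big , z≤a ∷ small ,
                     (Star.gmap (z ∷_) (Crossing-∷ z) r ◅◅ crossAll bs big z≤a)

-- Joins along a Baxter cover

join-mono : (J : Join n σ ρ) (K : Join n ν ρ) → σ ⊑ ν → Join.join J ⊑ Join.join K
join-mono J K σ⊑ν =
  Join.least J (Join.join↭ K) (⊑-trans σ⊑ν (Join.⊑joinˡ K)) (Join.⊑joinʳ K)

join-unique : (J K : Join n σ ρ) → Join.join J ≡ Join.join K
join-unique J K = ⊑-antisym (Join.join↭ J) (Join.join↭ K)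
  (join-mono J K (λ _ p → p)) (join-mono K J (λ _ p → p))

-- Reduces congruence in the right argument to the left one; for this, the lemmas on joins accept
-- arbitrary `Join` records and not only the output of `joins`.
join-comm : Join n σ ν → Join n ν σ
join-comm J = record
  { join = join ; join↭ = join↭ ; ⊑joinˡ = ⊑joinʳ ; ⊑joinʳ = ⊑joinˡ
  ; least = λ ρ↭ p q → least ρ↭ q p }
  where open Join J

module JoinCover (u v : Word) (x∈u : x ∈ u) (a<x : a < x) (x<d : x < d)
                 (y∈v : y ∈ v) (a<y : a < y) (y<d : y < d)
                 (σ↭ : u ++ a ∷ d ∷ v ↭ upTo n)
                 (J : Join n (u ++ a ∷ d ∷ v) ρ) (K : Join n (u ++ d ∷ a ∷ v) ρ) where

  τ τ′ : Word
  τ  = Join.join J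
  τ′ = Join.join K

  a<d : a < d
  a<d = <-trans a<x x<d

  uτ : Unique τ
  uτ = ↭upTo⇒Unique (Join.join↭ J)

  uτ′ : Unique τ′
  uτ′ = ↭upTo⇒Unique (Join.join↭ K)

  τ⊑τ′ : τ ⊑ τ′
  τ⊑τ′ = join-mono J K (⋖⇒⊑ (swap u v a<d))

  d-a′ : Before d a τ′
  d-a′ = Join.⊑joinˡ K a<d (before-++ʳ u (here (here refl)))

  ∈τ : z ∈ u ++ a ∷ d ∷ v → z ∈ τ
  ∈τ = ∈-resp-↭ (↭-trans σ↭ (↭-sym (Join.join↭ J)))

  z∈u⇒z-a : z ∈ u → a < z → Before z a τ
  z∈u⇒z-a z∈u a<z = Join.⊑joinˡ J a<z (before-prefix u z∈u)

  z∈v⇒d-z : z ∈ v → z < d → Before d z τ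
  z∈v⇒d-z z∈v z<d = Join.⊑joinˡ J z<d (before-++ʳ u (there (here z∈v)))

  -- By `swap-⊑`, such a `w` lies above `u ++ d ∷ a ∷ v` and above `ρ`, hence above their join `τ′`.
  join≡ : w ↭ upTo n → τ ⊑ w → Before d a w → w ⊑ τ′ → w ≡ τ′
  join≡ w↭ τ⊑w d-a w⊑τ′ = ⊑-antisym w↭ (Join.join↭ K) w⊑τ′
    (Join.least K w↭ (swap-⊑ u (⊑-trans (Join.⊑joinˡ J) τ⊑w) d-a) (⊑-trans (Join.⊑joinʳ J) τ⊑w))

  module Uninverted (p m s : Word) (eq : τ ≡ p ++ (a ∷ m ++ [ d ]) ++ s) where

    l : Word
    l = a ∷ m ++ [ d ]

    ∈τ⁻ : z ∈ τ → z ∈ p ⊎ z ∈ l ++ s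
    ∈τ⁻ z∈τ = ∈-++⁻ p (subst (_ ∈_) eq z∈τ)

    into : Before b z (p ++ l ++ s) → Before b z τ
    into = subst (Before _ _) (sym eq)

    d∈l : d ∈ l
    d∈l = ∈-insert (a ∷ m)

    after-a : z ∈ l ++ s → z ≡ a ⊎ Before a z τ
    after-a (here z≡a) = inj₁ z≡a
    after-a (there q)  = inj₂ (into (before-++ʳ p (here q)))

    before-d : z ∈ l → z ≡ d ⊎ Before z d τ
    before-d z∈l with ∈-++⁻ (a ∷ m) z∈l
    ... | inj₁ q          = inj₂ (into (before-++ʳ p (before-++ˡ s (before-prefix (a ∷ m) q))))
    ... | inj₂ (here z≡d) = inj₁ z≡d

    -- The inversion of `x` and `a` persists in `τ`, whereas no letter of `l ++ s` precedes `a`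
    -- there.
    x∈p : x ∈ p
    x∈p with ∈τ⁻ (before-∈ˡ (z∈u⇒z-a x∈u a<x))
    ... | inj₁ q = q
    ... | inj₂ q with after-a q
    ...   | inj₁ refl = ⊥-elim (<⇒≢ a<x refl)
    ...   | inj₂ a-x  = ⊥-elim (before-asym uτ a-x (z∈u⇒z-a x∈u a<x))

    y∈s : y ∈ s
    y∈s with ∈τ⁻ (before-∈ʳ (z∈v⇒d-z y∈v y<d))
    ... | inj₁ q = ⊥-elim (before-asym uτ (into (before-++ q (∈-++⁺ˡ d∈l))) (z∈v⇒d-z y∈v y<d))
    ... | inj₂ q with ∈-++⁻ l q
    ...   | inj₂ r = r
    ...   | inj₁ r with before-d r
    ...     | inj₁ refl = ⊥-elim (<⇒≢ y<d refl)
    ...     | inj₂ y-d  = ⊥-elim (before-asym uτ y-d (z∈v⇒d-z y∈v y<d))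

    no-between : z ∈ l → a < z → z < d → ⊥
    no-between z∈l a<z z<d with after-a (∈-++⁺ˡ z∈l) | before-d z∈l
    ... | inj₁ refl | _         = <⇒≢ a<z refl
    ... | inj₂ _    | inj₁ refl = <⇒≢ z<d refl
    ... | inj₂ a-z  | inj₂ z-d
      with ∈-++⁻ u (∈-resp-↭ (↭-trans (Join.join↭ J) (↭-sym σ↭)) (before-∈ʳ a-z))
    ...   | inj₁ z∈u                  = before-asym uτ a-z (z∈u⇒z-a z∈u a<z)
    ...   | inj₂ (here refl)          = <⇒≢ a<z refl
    ...   | inj₂ (there (here refl))  = <⇒≢ z<d refl
    ...   | inj₂ (there (there z∈v))  = before-asym uτ z-d (z∈v⇒d-z z∈v z<d)

    outside : z ∈ l → z ≤ a ⊎ d ≤ z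
    outside {z} z∈l with z ≤? a | d ≤? z
    ... | yes z≤a | _       = inj₁ z≤a
    ... | no  _   | yes d≤z = inj₂ d≤z
    ... | no  z≰a | no  d≰z = ⊥-elim (no-between z∈l (≰⇒> z≰a) (≰⇒> d≰z))

    d-small : z ∈ l → z ≤ a → Before d z τ′
    d-small z∈l z≤a with after-a (∈-++⁺ˡ z∈l)
    ... | inj₁ refl = d-a′
    ... | inj₂ a-z with m≤n⇒m<n∨m≡n z≤a
    ...   | inj₁ z<a  = before-trans uτ′ d-a′ (τ⊑τ′ z<a a-z)
    ...   | inj₂ refl = d-a′

    -- Up to equalities, `b`, `d`, `a`, `z` occur in this order in `τ′`: the outer two precedences
    -- are inversions of `τ`, which persist, and the middle one is `d-a′`.
    crossed : z ∈ l → z ≤ a → b ∈ l → d ≤ b → Before b z τ′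
    crossed z∈l z≤a b∈l d≤b with before-d b∈l
    ... | inj₁ refl = d-small z∈l z≤a
    ... | inj₂ b-d with m≤n⇒m<n∨m≡n d≤b
    ...   | inj₁ d<b  = before-trans uτ′ (τ⊑τ′ d<b b-d) (d-small z∈l z≤a)
    ...   | inj₂ refl = d-small z∈l z≤a

    τ≡Bτ′ : τ ≡B τ′
    τ≡Bτ′ with sort a d (All.tabulate outside)
    ... | bs , ss , big , small , r = subst (τ ≡B_) w≡τ′ (Star⋖B⇒≡B τ⟶w)
      where
      w′ : Word
      w′ = p ++ (bs ++ ss) ++ s

      l↭ : l ↭ bs ++ ss
      l↭ = StarCrossing⇒↭ a d r

      τ⟶w : Star _⋖B_ τ w′
      τ⟶w = subst (λ t → Star _⋖B_ t w′) (sym eq)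
        (Star.gmap (λ t → p ++ t ++ s) (Crossing⇒⋖B a d p s x∈p a<x x<d y∈s a<y y<d) r)

      d∈bs : d ∈ bs
      d∈bs with ∈-++⁻ bs (∈-resp-↭ l↭ d∈l)
      ... | inj₁ q = q
      ... | inj₂ q = ⊥-elim (<⇒≱ a<d (All.lookup small q))

      a∈ss : a ∈ ss
      a∈ss with ∈-++⁻ bs (∈-resp-↭ l↭ (here refl))
      ... | inj₁ q = ⊥-elim (<⇒≱ a<d (All.lookup big q))
      ... | inj₂ q = q

      -- Sorting only moves up from `τ`, it puts `d` before `a`, and by `crossed` it never leaves
      -- the words below `τ′`.
      w≡τ′ : w′ ≡ τ′
      w≡τ′ = join≡ (↭-trans (↭-sym (≡B⇒↭ (Star⋖B⇒≡B τ⟶w))) (Join.join↭ J))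
        (Star⇒⊑ (Star.map ⋖B⇒⋖ τ⟶w))
        (before-++ʳ p (before-++ˡ s (before-++ d∈bs a∈ss)))
        (StarCrossing-⊑ a d p s r crossed (subst (_⊑ τ′) eq τ⊑τ′))

  τ≡Bτ′ : τ ≡B τ′
  τ≡Bτ′ with before-total (∈τ (∈-++⁺ʳ u (there (here refl)))) (∈τ (∈-insert u)) (<⇒≢ a<d ∘ sym)
  ... | inj₁ d-a = subst (τ ≡B_) (join≡ (Join.join↭ J) (λ _ q → q) d-a τ⊑τ′) B-refl
  ... | inj₂ a-d with before-∃++ a-d
  ...   | p , m , s , eq = Uninverted.τ≡Bτ′ p m s eq

-- Congruence of joins and meets

join-⋖B : σ ↭ upTo n → σ ⋖B ν → (J : Join n σ ρ) (K : Join n ν ρ) → Join.join J ≡B Join.join K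
join-⋖B σ↭ (swap u v x∈u a<x x<d y∈v a<y y<d) J K =
  JoinCover.τ≡Bτ′ u v x∈u a<x x<d y∈v a<y y<d σ↭ J K

join-EqClosure : σ ↭ upTo n → ρ ↭ upTo n → EqClosure _⋖B_ σ ν →
                 (J : Join n σ ρ) (K : Join n ν ρ) → Join.join J ≡B Join.join K
-- Even here `J` and `K` may be different records for the same pair of words.
join-EqClosure σ↭ ρ↭ ε J K = subst (Join.join J ≡B_) (join-unique J K) B-refl
join-EqClosure σ↭ ρ↭ (fwd s ◅ r) J K =
  B-trans (join-⋖B σ↭ s J I) (join-EqClosure μ↭ ρ↭ r I K)
  where
  μ↭ = ↭-trans (↭-sym (⋖⇒↭ (⋖B⇒⋖ s))) σ↭
  I  = joins _ μ↭ ρ↭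
join-EqClosure σ↭ ρ↭ (bwd s ◅ r) J K =
  B-trans (B-sym (join-⋖B μ↭ s I J)) (join-EqClosure μ↭ ρ↭ r I K)
  where
  μ↭ = ↭-trans (⋖⇒↭ (⋖B⇒⋖ s)) σ↭
  I  = joins _ μ↭ ρ↭

join-congˡ : σ ↭ upTo n → ρ ↭ upTo n → σ ≡B ν →
             (J : Join n σ ρ) (K : Join n ν ρ) → Join.join J ≡B Join.join K
join-congˡ σ↭ ρ↭ p = join-EqClosure σ↭ ρ↭ (≡B⇒EqClosure (↭upTo⇒Unique σ↭) p)

∨P-cong : (σ σ′ ν ν′ : 𝔖 n) → word σ ≡B word σ′ → word ν ≡B word ν′ →
          word (σ ∨P ν) ≡B word (σ′ ∨P ν′)
∨P-cong σ σ′ ν ν′ p q = B-trans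
  (join-congˡ (word↭ σ) (word↭ ν) p (joins _ _ _) I)
  (join-congˡ (word↭ ν) (word↭ σ′) q (join-comm I) (join-comm (joins _ _ _)))
  -- The intermediate join allows one argument to change at a time.
  where I = joins _ (word↭ σ′) (word↭ ν)

rev-cong : (σ ν : 𝔖 n) → word σ ≡B word ν → word (rev σ) ≡B word (rev ν)
rev-cong σ ν = ≡B-reverse (𝔖.unique σ)

theorem5p1 : (n : ℕ) → IsLatticeCongruence (permutohedron n) (_≡B_ on word)
theorem5p1 n = record
  { ≈⇒~           = λ {σ} eq → subst (word σ ≡B_) eq B-refl
  ; isEquivalence = record { refl = B-refl ; sym = B-sym ; trans = B-trans }
  -- The meet is the join conjugated by `rev`, and `rev` respects `≡B`.
  ; ∧-cong        = λ {σ} {σ′} {ν} {ν′} p q →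
      rev-cong (rev σ ∨P rev ν) (rev σ′ ∨P rev ν′)
        (∨P-cong (rev σ) (rev σ′) (rev ν) (rev ν′) (rev-cong σ σ′ p) (rev-cong ν ν′ q))
  ; ∨-cong        = λ {σ} {σ′} {ν} {ν′} → ∨P-cong σ σ′ ν ν′
  }
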